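{- (1) Invariance: if $t\to_w u$ then $t\equiv^{typ} u$. (2) Compatibility: if $t\equiv^{typ}u$ then $C\langle t\rangle\equiv^{typ} C\langle u\rangle$ for every context $C$.
   Context: Terms: $t ::= x \mid \lambda x.t \mid t\,u \mid t[x\backslash u]$ ($t[x\backslash u]$ an explicit substitution binding $x$ in $t$; terms up to $\alpha$). Values $v ::= \lambda x.t$. Substitution contexts $S ::= \langle\cdot\rangle\mid S[x\backslash u]$. Weak contexts $W ::= \langle\cdot\rangle \mid W\,t \mid t\,W \mid t[x\backslash W] \mid W[x\backslash u]$; $W\langle\langle t\rangle\rangle$ is plugging without capture of free variables of $t$. Root rules: $S\langle\lambda x.t\rangle u\mapsto_m S\langle t[x\backslash u]\rangle$; $W\langle\langle x\rangle\rangle[x\backslash u]\mapsto_e W\langle\langle u\rangle\rangle[x\backslash u]$; $t[x\backslash S\langle v\rangle]\mapsto_{gcv} S\langle t\rangle$ if $x\notin\mathrm{fv}(t)$. $\to_w$ is the union of their closures under weak contexts. A context $C$ is a term with exactly one hole, anywhere (also under abstraction or inside ESs). Silly multi types: linear types $L ::= \mathtt{n} \mid M\multimap L$; multi types $M ::= [L_i]_{i\in I}$ finite multisets ($\mathbf{0}$ empty, $\uplus$ sum). Type contexts $\Gamma$ map variables to multi types with finite support; $\uplus$ pointwise; $\Gamma\setminus\!\!\setminus x$ sets $x$ to $\mathbf{0}$. Rules: (ax) $x:[L]\vdash^{(0,1)} x:L$; (many) from $(\Gamma_i\vdash^{(m_i,e_i)} t : L_i)_{i\in I}$, $I$ finite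 possibly empty, infer $\uplus_i\Gamma_i\vdash^{(\sum m_i,\sum e_i)} t : [L_i]_{i\in I}$; ($\mathrm{ax}_\lambda$) $\vdash^{(0,0)}\lambda x.t:\mathtt{n}$; ($\lambda$) from $\Gamma\vdash^{(m,e)}t:L$ infer $\Gamma\setminus\!\!\setminus x\vdash^{(m,e)}\lambda x.t:\Gamma(x)\multimap L$; (@) from $\Gamma\vdash^{(m,e)} t : M\multimap L$ and $\Delta\vdash^{(m',e')} u : M\uplus[\mathtt{n}]$ infer $\Gamma\uplus\Delta\vdash^{(m+m'+1,e+e')} tu : L$; (ES) from $\Gamma\vdash^{(m,e)} t:L$ and $\Delta\vdash^{(m',e')}u:\Gamma(x)\uplus[\mathtt{n}]$ infer $(\Gamma\setminus\!\!\setminus x)\uplus\Delta\vdash^{(m+m',e+e')} t[x\backslash u]:L$. Type equivalence: $t\equiv^{typ}u$ iff for all $\Gamma$ and linear types $L$, $\Gamma\vdash t:L$ is derivable iff $\Gamma\vdash u:L$ is derivable (indices ignored). -}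

module Defs where

open import Data.Fin using (Fin; zero; suc)
open import Data.List using (List; []; [_]; _++_; tabulate)
open import Data.List.Relation.Binary.Permutation.Homogeneous using (Permutation)
open import Data.Nat using (ℕ; suc; _+_)
open import Data.Product using (∃-syntax)
open import Data.Sum using (_⊎_)
open import Data.Vec.Functional using (foldr; head; tail; updateAt)
open import Function using (id; _∘_; const; _⇔_)

-- Terms up to α-equivalence are well-scoped de Bruijn terms: Tm n has its
-- free variables in Fin n.  In t [\ u ], index zero of t is bound to u.

infixl 9 _·_
infixl 10 _[\_]

data Tm (n : ℕ) : Set where
  var   : Fin n → Tm n
  ƛ     : Tm (suc n) → Tm n
  _·_   : Tm n → Tm n → Tm n
  _[\_] : Tm (suc n) → Tm n → Tm n

data Value {n : ℕ} : Tm n → Set where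
  ƛ : (t : Tm (suc n)) → Value (ƛ t)

lift : ∀ {n m} → (Fin n → Fin m) → Fin (suc n) → Fin (suc m)
lift ρ zero    = zero
lift ρ (suc i) = suc (ρ i)

rename : ∀ {n m} → (Fin n → Fin m) → Tm n → Tm m
rename ρ (var x)    = var (ρ x)
rename ρ (ƛ t)      = ƛ (rename (lift ρ) t)
rename ρ (t · u)    = rename ρ t · rename ρ u
rename ρ (t [\ u ]) = rename (lift ρ) t [\ rename ρ u ]

weaken : ∀ {n} → Tm n → Tm (suc n)
weaken = rename suc

-- For all three kinds of contexts, the first index is the scope of the whole
-- term after plugging and the second one is the scope at the hole.  _⟨_⟩
-- may capture; _⟨⟨_⟩⟩ first weakens the plugged term past the binders
-- crossed by the hole, hence is capture-avoiding.

data SubstCtx (n : ℕ) : ℕ → Set where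
  ∙     : SubstCtx n n
  _[\_] : ∀ {m} → SubstCtx (suc n) m → Tm n → SubstCtx n m

infix 11 _⟨_⟩ˢ _⟨⟨_⟩⟩ˢ _⟨_⟩ʷ _⟨⟨_⟩⟩ʷ _⟨_⟩

_⟨_⟩ˢ : ∀ {n m} → SubstCtx n m → Tm m → Tm n
∙          ⟨ t ⟩ˢ = t
(S [\ u ]) ⟨ t ⟩ˢ = S ⟨ t ⟩ˢ [\ u ]

pastˢ : ∀ {n m} → SubstCtx n m → Fin n → Fin m
pastˢ ∙          = id
pastˢ (S [\ u ]) = pastˢ S ∘ suc

_⟨⟨_⟩⟩ˢ : ∀ {n m} → SubstCtx n m → Tm n → Tm n
S ⟨⟨ t ⟩⟩ˢ = S ⟨ rename (pastˢ S) t ⟩ˢ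

data WeakCtx (n : ℕ) : ℕ → Set where
  ∙      : WeakCtx n n
  _·ˡ_   : ∀ {m} → WeakCtx n m → Tm n → WeakCtx n m
  _·ʳ_   : ∀ {m} → Tm n → WeakCtx n m → WeakCtx n m
  _[\_]ʳ : ∀ {m} → Tm (suc n) → WeakCtx n m → WeakCtx n m
  _[\_]ˡ : ∀ {m} → WeakCtx (suc n) m → Tm n → WeakCtx n m

_⟨_⟩ʷ : ∀ {n m} → WeakCtx n m → Tm m → Tm n
∙           ⟨ t ⟩ʷ = t
(W ·ˡ u)    ⟨ t ⟩ʷ = W ⟨ t ⟩ʷ · u
(u ·ʳ W)    ⟨ t ⟩ʷ = u · W ⟨ t ⟩ʷ
(u [\ W ]ʳ) ⟨ t ⟩ʷ = u [\ W ⟨ t ⟩ʷ ]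
(W [\ u ]ˡ) ⟨ t ⟩ʷ = W ⟨ t ⟩ʷ [\ u ]

pastʷ : ∀ {n m} → WeakCtx n m → Fin n → Fin m
pastʷ ∙           = id
pastʷ (W ·ˡ u)    = pastʷ W
pastʷ (u ·ʳ W)    = pastʷ W
pastʷ (u [\ W ]ʳ) = pastʷ W
pastʷ (W [\ u ]ˡ) = pastʷ W ∘ suc

_⟨⟨_⟩⟩ʷ : ∀ {n m} → WeakCtx n m → Tm n → Tm n
W ⟨⟨ t ⟩⟩ʷ = W ⟨ rename (pastʷ W) t ⟩ʷ

data Ctx (n : ℕ) : ℕ → Set where
  ∙      : Ctx n n
  ƛ      : ∀ {m} → Ctx (suc n) m → Ctx n m
  _·ˡ_   : ∀ {m} → Ctx n m → Tm n → Ctx n m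
  _·ʳ_   : ∀ {m} → Tm n → Ctx n m → Ctx n m
  _[\_]ʳ : ∀ {m} → Tm (suc n) → Ctx n m → Ctx n m
  _[\_]ˡ : ∀ {m} → Ctx (suc n) m → Tm n → Ctx n m

_⟨_⟩ : ∀ {n m} → Ctx n m → Tm m → Tm n
∙           ⟨ t ⟩ = t
(ƛ C)       ⟨ t ⟩ = ƛ (C ⟨ t ⟩)
(C ·ˡ u)    ⟨ t ⟩ = C ⟨ t ⟩ · u
(u ·ʳ C)    ⟨ t ⟩ = u · C ⟨ t ⟩
(u [\ C ]ʳ) ⟨ t ⟩ = u [\ C ⟨ t ⟩ ]
(C [\ u ]ˡ) ⟨ t ⟩ = C ⟨ t ⟩ [\ u ]

infix 4 _↦m_ _↦e_ _↦gcv_ _→w_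

-- u is moved under the binders of S.
data _↦m_ {n : ℕ} : Tm n → Tm n → Set where
  m : ∀ {k} (S : SubstCtx n k) (t : Tm (suc k)) (u : Tm n) →
      S ⟨ ƛ t ⟩ˢ · u ↦m S ⟨ t [\ rename (pastˢ S) u ] ⟩ˢ

data _↦e_ {n : ℕ} : Tm n → Tm n → Set where
  e : ∀ {k} (W : WeakCtx (suc n) k) (u : Tm n) →
      W ⟨⟨ var zero ⟩⟩ʷ [\ u ] ↦e W ⟨⟨ weaken u ⟩⟩ʷ [\ u ]

-- The side condition x ∉ fv(t) says that the body of the explicit
-- substitution is the weakening of a term t not having x in its scope.
data _↦gcv_ {n : ℕ} : Tm n → Tm n → Set where
  gcv : ∀ {k} (t : Tm n) (S : SubstCtx n k) {v : Tm k} → Value v →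
        weaken t [\ S ⟨ v ⟩ˢ ] ↦gcv S ⟨⟨ t ⟩⟩ˢ

data WeakClosure (R : ∀ {k} → Tm k → Tm k → Set) {n : ℕ} : Tm n → Tm n → Set where
  close : ∀ {k} (W : WeakCtx n k) {t u : Tm k} → R t u →
          WeakClosure R (W ⟨ t ⟩ʷ) (W ⟨ u ⟩ʷ)

_→w_ : ∀ {n} → Tm n → Tm n → Set
t →w u = WeakClosure _↦m_ t u ⊎ WeakClosure _↦e_ t u ⊎ WeakClosure _↦gcv_ t u

-- Multi types are lists, considered up to permutation, hereditarily: _≈ᴸ_
-- and _≈ᴹ_ are the equalities of linear and multi types as multisets.

infixr 6 _⊸_
infix 4 _≈ᴸ_ _≈ᴹ_ _≈ᶜ_

data Linear : Set where
  𝚗   : Linear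
  _⊸_ : List Linear → Linear → Linear

Multi : Set
Multi = List Linear

data _≈ᴸ_ : Linear → Linear → Set where
  𝚗   : 𝚗 ≈ᴸ 𝚗
  _⊸_ : ∀ {M M′ L L′} → Permutation _≈ᴸ_ M M′ → L ≈ᴸ L′ → M ⊸ L ≈ᴸ M′ ⊸ L′

_≈ᴹ_ : Multi → Multi → Set
_≈ᴹ_ = Permutation _≈ᴸ_

-- Over the finite scope Fin n, every type context has finite support.
TyCtx : ℕ → Set
TyCtx n = Fin n → Multi

_≈ᶜ_ : ∀ {n} → TyCtx n → TyCtx n → Set
Γ ≈ᶜ Δ = ∀ x → Γ x ≈ᴹ Δ x

∅ : ∀ {n} → TyCtx n
∅ x = []

_∶[_] : ∀ {n} → Fin n → Linear → TyCtx n
x ∶[ L ] = updateAt ∅ x (const [ L ])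

infixr 5 _⊎ᶜ_

_⊎ᶜ_ : ∀ {n} → TyCtx n → TyCtx n → TyCtx n
(Γ ⊎ᶜ Δ) x = Γ x ++ Δ x

⨄ : ∀ {n k} → (Fin k → TyCtx n) → TyCtx n
⨄ = foldr _⊎ᶜ_ ∅

∑ : ∀ {k} → (Fin k → ℕ) → ℕ
∑ = foldr _+_ 0

infix 3 _⊢⟨_,_⟩_∶_ _⊢⟨_,_⟩_∶ᴹ_ _⊢_∶_ _≡typ_

-- For Γ typing the body of a binder of x, head Γ is Γ(x), and tail Γ is
-- Γ ∖∖ x, the variable x being out of scope in the conclusion.  The rules
-- conv and convᴹ are not proper rules: they express that types and type
-- contexts are built from multisets rather than lists.
mutual
  data _⊢⟨_,_⟩_∶_ {n : ℕ} : TyCtx n → ℕ → ℕ → Tm n → Linear → Set where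
    ax   : ∀ {x L} → x ∶[ L ] ⊢⟨ 0 , 1 ⟩ var x ∶ L
    axλ  : ∀ {t} → ∅ ⊢⟨ 0 , 0 ⟩ ƛ t ∶ 𝚗
    lam  : ∀ {Γ m e t L} →
           Γ ⊢⟨ m , e ⟩ t ∶ L →
           tail Γ ⊢⟨ m , e ⟩ ƛ t ∶ head Γ ⊸ L
    app  : ∀ {Γ Δ m e m′ e′ t u M L} →
           Γ ⊢⟨ m , e ⟩ t ∶ M ⊸ L →
           Δ ⊢⟨ m′ , e′ ⟩ u ∶ᴹ M ++ [ 𝚗 ] →
           Γ ⊎ᶜ Δ ⊢⟨ m + m′ + 1 , e + e′ ⟩ t · u ∶ L
    es   : ∀ {Γ Δ m e m′ e′ t u L} →
           Γ ⊢⟨ m , e ⟩ t ∶ L →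
           Δ ⊢⟨ m′ , e′ ⟩ u ∶ᴹ head Γ ++ [ 𝚗 ] →
           tail Γ ⊎ᶜ Δ ⊢⟨ m + m′ , e + e′ ⟩ t [\ u ] ∶ L
    conv : ∀ {Γ Γ′ m e t L L′} →
           Γ ≈ᶜ Γ′ → L ≈ᴸ L′ →
           Γ ⊢⟨ m , e ⟩ t ∶ L →
           Γ′ ⊢⟨ m , e ⟩ t ∶ L′

  data _⊢⟨_,_⟩_∶ᴹ_ {n : ℕ} : TyCtx n → ℕ → ℕ → Tm n → Multi → Set where
    many  : ∀ {k t} {Γ : Fin k → TyCtx n} {m e : Fin k → ℕ} {L : Fin k → Linear} →
            (∀ i → Γ i ⊢⟨ m i , e i ⟩ t ∶ L i) →
            ⨄ Γ ⊢⟨ ∑ m , ∑ e ⟩ t ∶ᴹ tabulate L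
    convᴹ : ∀ {Γ Γ′ m e t M M′} →
            Γ ≈ᶜ Γ′ → M ≈ᴹ M′ →
            Γ ⊢⟨ m , e ⟩ t ∶ᴹ M →
            Γ′ ⊢⟨ m , e ⟩ t ∶ᴹ M′

_⊢_∶_ : ∀ {n} → TyCtx n → Tm n → Linear → Set
Γ ⊢ t ∶ L = ∃[ m ] ∃[ e ] (Γ ⊢⟨ m , e ⟩ t ∶ L)

_≡typ_ : ∀ {n} → Tm n → Tm n → Set
t ≡typ u = ∀ Γ L → (Γ ⊢ t ∶ L) ⇔ (Γ ⊢ u ∶ L)

{-# OPTIONS --safe #-}
module Submission where

-- Typability is compositional: the set ⟦ t ⟧ of pairs (Γ , L) with Γ ⊢ t ∶ L
-- is computed from the sets of the immediate subterms of t by operations that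
-- are monotone for inclusion, which gives compatibility.  Hence invariance is
-- needed for the root rules only.  For ↦m and ↦gcv, the substitution context S
-- is moved one explicit substitution at a time.  For ↦e, a typing of W⟨⟨t⟩⟩
-- splits into typings of t with some multi type M, and a typing of W that can
-- be filled with any other term of type M; the occurrence of x and the copy of
-- u are thus exchanged by moving the typings of u with M between the explicit
-- substitution and the hole.

open import Defs
open import Algebra.Bundles using (CommutativeMonoid)
import Algebra.Construct.Pointwise as Pointwise
import Algebra.Properties.CommutativeSemigroup as CommutativeSemigroupProperties
open import Data.Fin using (Fin; zero; suc)
open import Data.List using ([]; _∷_; [_]; _++_; tabulate)
open import Data.List.Relation.Binary.Permutation.Homogeneous using (refl; prep; swap; trans)
import Data.List.Relation.Binary.Permutation.Setoid.Properties as PermutationProperties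
import Data.List.Relation.Binary.Pointwise as PW
open import Data.Nat using (ℕ; suc)
open import Data.Product using (_×_; _,_; proj₁; proj₂; ∃-syntax)
open import Data.Sum using (inj₁; inj₂)
open import Data.Vec.Functional using (head; tail) renaming (_∷_ to _∷ᶜ_)
open import Function using (_∘_; mk⇔; Equivalence)
open import Level using (0ℓ)
open import Relation.Binary.Bundles using (Setoid)
open import Relation.Binary.PropositionalEquality as ≡ using (_≡_; cong; cong₂)

private
  variable
    n k : ℕ
    Γ Γ′ Δ : TyCtx n
    L L′ : Linear
    M N : Multi

-- Multisets of types

mutual
  ≈ᴸ-refl : L ≈ᴸ L
  ≈ᴸ-refl {𝚗}     = 𝚗
  ≈ᴸ-refl {M ⊸ L} = refl ≋-refl ⊸ ≈ᴸ-refl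

  ≋-refl : PW.Pointwise _≈ᴸ_ M M
  ≋-refl {[]}    = PW.[]
  ≋-refl {L ∷ M} = ≈ᴸ-refl PW.∷ ≋-refl

mutual
  ≈ᴸ-sym : L ≈ᴸ L′ → L′ ≈ᴸ L
  ≈ᴸ-sym 𝚗       = 𝚗
  ≈ᴸ-sym (p ⊸ q) = ↭-sym p ⊸ ≈ᴸ-sym q

  ↭-sym : M ≈ᴹ N → N ≈ᴹ M
  ↭-sym (refl p)     = refl (≋-sym p)
  ↭-sym (prep q p)   = prep (≈ᴸ-sym q) (↭-sym p)
  ↭-sym (swap q r p) = swap (≈ᴸ-sym r) (≈ᴸ-sym q) (↭-sym p)
  ↭-sym (trans p q)  = trans (↭-sym q) (↭-sym p)

  ≋-sym : PW.Pointwise _≈ᴸ_ M N → PW.Pointwise _≈ᴸ_ N M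
  ≋-sym PW.[]       = PW.[]
  ≋-sym (q PW.∷ qs) = ≈ᴸ-sym q PW.∷ ≋-sym qs

-- Transitivity is a constructor of `Permutation`, so the recursion only follows the result types.
≈ᴸ-trans : ∀ {L₁ L₂ L₃} → L₁ ≈ᴸ L₂ → L₂ ≈ᴸ L₃ → L₁ ≈ᴸ L₃
≈ᴸ-trans 𝚗       𝚗         = 𝚗
≈ᴸ-trans (p ⊸ q) (p′ ⊸ q′) = trans p p′ ⊸ ≈ᴸ-trans q q′

linearSetoid : Setoid 0ℓ 0ℓ
linearSetoid = record
  { Carrier       = Linear
  ; _≈_           = _≈ᴸ_
  ; isEquivalence = record { refl = ≈ᴸ-refl ; sym = ≈ᴸ-sym ; trans = ≈ᴸ-trans }
  }

module Multiset where
  open PermutationProperties linearSetoid public using (++-commutativeMonoid)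
  open CommutativeMonoid ++-commutativeMonoid public
  open CommutativeSemigroupProperties commutativeSemigroup public

module TypeContext {n : ℕ} where
  open CommutativeMonoid (Pointwise.commutativeMonoid (Fin n) Multiset.++-commutativeMonoid) public
  open CommutativeSemigroupProperties commutativeSemigroup public

open TypeContext using (xy∙z≈xz∙y; interchange)
  renaming ( refl to ≈ᶜ-refl; sym to ≈ᶜ-sym; trans to ≈ᶜ-trans; ∙-cong to ⊎ᶜ-cong; ∙-congˡ to ⊎ᶜ-congˡ
           ; ∙-congʳ to ⊎ᶜ-congʳ; assoc to ⊎ᶜ-assoc; comm to ⊎ᶜ-comm; identityˡ to ⊎ᶜ-identityˡ
           ; identityʳ to ⊎ᶜ-identityʳ)

∷ᶜ-cong : M ≈ᴹ N → Γ ≈ᶜ Δ → M ∷ᶜ Γ ≈ᶜ N ∷ᶜ Δ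
∷ᶜ-cong p q zero    = p
∷ᶜ-cong p q (suc x) = q x

-- Type contexts are functions, so the decomposition at index zero holds only pointwise and each use
-- of it is a conversion.
head-tail : head Γ ≈ᴹ M → Γ ≈ᶜ M ∷ᶜ tail Γ
head-tail p zero    = p
head-tail p (suc x) = Multiset.refl

∶[]-cong : (x : Fin n) → L ≈ᴸ L′ → x ∶[ L ] ≈ᶜ x ∶[ L′ ]
∶[]-cong zero    p zero    = prep p Multiset.refl
∶[]-cong zero    p (suc y) = Multiset.refl
∶[]-cong (suc x) p zero    = Multiset.refl
∶[]-cong (suc x) p (suc y) = ∶[]-cong x p y

-- Sets of typings

Typings : ℕ → Set₁
Typings n = TyCtx n → Linear → Set

private
  variable
    P P′ Q Q′ : Typings n

infix 4 _⊆_

_⊆_ : Typings n → Typings n → Set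
P ⊆ Q = ∀ {Γ L} → P Γ L → Q Γ L

Respects≈ : Typings n → Set
Respects≈ P = ∀ {Γ Γ′ L L′} → Γ ≈ᶜ Γ′ → L ≈ᴸ L′ → P Γ L → P Γ′ L′

-- Here and in the next three operations the conversion of contexts is absorbed by the premise on
-- `Γ`, and the indices, which type equivalence ignores, are dropped. Inverting a typing is then
-- pattern matching.
data Many (P : Typings n) (Γ : TyCtx n) : Multi → Set where
  none : Γ ≈ᶜ ∅ → Many P Γ []
  more : ∀ Γ₁ Γ₂ → Γ ≈ᶜ Γ₁ ⊎ᶜ Γ₂ → P Γ₁ L → Many P Γ₂ M → Many P Γ (L ∷ M)

data Abs (P : Typings (suc n)) (Γ : TyCtx n) : Linear → Set where
  normal : Γ ≈ᶜ ∅ → Abs P Γ 𝚗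
  arrow  : P (M ∷ᶜ Γ) L → Abs P Γ (M ⊸ L)

data App (P Q : Typings n) (Γ : TyCtx n) (L : Linear) : Set where
  app : ∀ Γ₁ Γ₂ → Γ ≈ᶜ Γ₁ ⊎ᶜ Γ₂ → P Γ₁ (M ⊸ L) → Many Q Γ₂ (M ++ [ 𝚗 ]) → App P Q Γ L

data Es (P : Typings (suc n)) (Q : Typings n) (Γ : TyCtx n) (L : Linear) : Set where
  es : ∀ Γ₁ Γ₂ → Γ ≈ᶜ Γ₁ ⊎ᶜ Γ₂ → P (M ∷ᶜ Γ₁) L → Many Q Γ₂ (M ++ [ 𝚗 ]) → Es P Q Γ L

Many-resp-≈ᶜ : Γ ≈ᶜ Γ′ → Many P Γ M → Many P Γ′ M
Many-resp-≈ᶜ p (none q)           = none (≈ᶜ-trans (≈ᶜ-sym p) q)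
Many-resp-≈ᶜ p (more Γ₁ Γ₂ q x xs) = more Γ₁ Γ₂ (≈ᶜ-trans (≈ᶜ-sym p) q) x xs

Many-resp-≈ᴹ : Respects≈ P → M ≈ᴹ N → Many P Γ M → Many P Γ N
Many-resp-≈ᴹ resp (refl PW.[])       xs = xs
Many-resp-≈ᴹ resp (refl (q PW.∷ qs)) (more Γ₁ Γ₂ eq x xs) =
  more Γ₁ Γ₂ eq (resp ≈ᶜ-refl q x) (Many-resp-≈ᴹ resp (refl qs) xs)
Many-resp-≈ᴹ resp (prep q p) (more Γ₁ Γ₂ eq x xs) =
  more Γ₁ Γ₂ eq (resp ≈ᶜ-refl q x) (Many-resp-≈ᴹ resp p xs)
Many-resp-≈ᴹ resp (swap q r p) (more Γ₁ Γ₂ eq x (more Γ₃ Γ₄ eq′ y xs)) =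
  more Γ₃ (Γ₁ ⊎ᶜ Γ₄) (≈ᶜ-trans eq (≈ᶜ-trans (⊎ᶜ-congˡ eq′) (TypeContext.x∙yz≈y∙xz Γ₁ Γ₃ Γ₄)))
    (resp ≈ᶜ-refl r y) (more Γ₁ Γ₄ ≈ᶜ-refl (resp ≈ᶜ-refl q x) (Many-resp-≈ᴹ resp p xs))
Many-resp-≈ᴹ resp (trans p q) xs = Many-resp-≈ᴹ resp q (Many-resp-≈ᴹ resp p xs)

Many-mono : P ⊆ Q → Many P Γ M → Many Q Γ M
Many-mono f (none eq)             = none eq
Many-mono f (more Γ₁ Γ₂ eq x xs) = more Γ₁ Γ₂ eq (f x) (Many-mono f xs)

Many-++ : Many P Γ M → Many P Δ N → Many P (Γ ⊎ᶜ Δ) (M ++ N)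
Many-++ (none eq) ys = Many-resp-≈ᶜ (≈ᶜ-sym (≈ᶜ-trans (⊎ᶜ-congʳ eq) (⊎ᶜ-identityˡ _))) ys
Many-++ {Δ = Δ} (more Γ₁ Γ₂ eq x xs) ys =
  more Γ₁ (Γ₂ ⊎ᶜ Δ) (≈ᶜ-trans (⊎ᶜ-congʳ eq) (⊎ᶜ-assoc Γ₁ Γ₂ Δ)) x (Many-++ xs ys)

Many-++⁻ : ∀ M → Many P Γ (M ++ N) → ∃[ Γ₁ ] ∃[ Γ₂ ] (Γ ≈ᶜ Γ₁ ⊎ᶜ Γ₂) × Many P Γ₁ M × Many P Γ₂ N
Many-++⁻ {Γ = Γ} [] xs = ∅ , Γ , ≈ᶜ-sym (⊎ᶜ-identityˡ Γ) , none ≈ᶜ-refl , xs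
Many-++⁻ (L ∷ M) (more Γ₁ Γ₂ eq x xs) with Many-++⁻ M xs
... | Γ₃ , Γ₄ , eq′ , ys , zs =
  Γ₁ ⊎ᶜ Γ₃ , Γ₄ , ≈ᶜ-trans eq (≈ᶜ-trans (⊎ᶜ-congˡ eq′) (≈ᶜ-sym (⊎ᶜ-assoc Γ₁ Γ₃ Γ₄))) ,
  more Γ₁ Γ₃ ≈ᶜ-refl x ys , zs

Many-[] : P Γ L → Many P Γ [ L ]
Many-[] {Γ = Γ} x = more Γ ∅ (≈ᶜ-sym (⊎ᶜ-identityʳ Γ)) x (none ≈ᶜ-refl)

Many-[]⁻ : Respects≈ P → Many P Γ [ L ] → P Γ L
Many-[]⁻ resp (more Γ₁ Γ₂ eq x (none eq′)) =
  resp (≈ᶜ-sym (≈ᶜ-trans eq (≈ᶜ-trans (⊎ᶜ-congˡ eq′) (⊎ᶜ-identityʳ Γ₁)))) ≈ᴸ-refl x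

Abs-mono : P ⊆ P′ → Abs P ⊆ Abs P′
Abs-mono f (normal eq) = normal eq
Abs-mono f (arrow x)  = arrow (f x)

App-mono : P ⊆ P′ → Q ⊆ Q′ → App P Q ⊆ App P′ Q′
App-mono f g (app Γ₁ Γ₂ eq x ys) = app Γ₁ Γ₂ eq (f x) (Many-mono g ys)

Es-mono : P ⊆ P′ → Q ⊆ Q′ → Es P Q ⊆ Es P′ Q′
Es-mono f g (es Γ₁ Γ₂ eq x ys) = es Γ₁ Γ₂ eq (f x) (Many-mono g ys)

-- Interpretation of terms

⟦_⟧ : Tm n → Typings n
⟦ var x ⟧ Γ L = Γ ≈ᶜ x ∶[ L ]
⟦ ƛ t ⟧       = Abs ⟦ t ⟧
⟦ t · u ⟧     = App ⟦ t ⟧ ⟦ u ⟧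
⟦ t [\ u ] ⟧  = Es ⟦ t ⟧ ⟦ u ⟧

-- This is the admissibility of `conv`. In an application the multiset `M` is internal to the
-- typing, so it is kept and only the result type is converted.
⟦_⟧-resp : (t : Tm n) → Respects≈ ⟦ t ⟧
⟦ var x ⟧-resp p q eq = ≈ᶜ-trans (≈ᶜ-sym p) (≈ᶜ-trans eq (∶[]-cong x q))
⟦ ƛ t ⟧-resp p 𝚗 (normal eq) = normal (≈ᶜ-trans (≈ᶜ-sym p) eq)
⟦ ƛ t ⟧-resp p (q ⊸ r) (arrow x) = arrow (⟦ t ⟧-resp (∷ᶜ-cong q p) r x)
⟦ t · u ⟧-resp p q (app Γ₁ Γ₂ eq x ys) =
  app Γ₁ Γ₂ (≈ᶜ-trans (≈ᶜ-sym p) eq) (⟦ t ⟧-resp ≈ᶜ-refl (Multiset.refl ⊸ q) x) ys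
⟦ t [\ u ] ⟧-resp p q (es Γ₁ Γ₂ eq x ys) =
  es Γ₁ Γ₂ (≈ᶜ-trans (≈ᶜ-sym p) eq) (⟦ t ⟧-resp ≈ᶜ-refl q x) ys

⟦_⟧-respᶜ : (t : Tm n) → Γ ≈ᶜ Γ′ → ⟦ t ⟧ Γ L → ⟦ t ⟧ Γ′ L
⟦ t ⟧-respᶜ p = ⟦ t ⟧-resp p ≈ᴸ-refl

-- Soundness and completeness of the interpretation

Many-tabulate : {Γ : Fin k → TyCtx n} {L : Fin k → Linear} →
                (∀ i → P (Γ i) (L i)) → Many P (⨄ Γ) (tabulate L)
Many-tabulate {k = ℕ.zero} f = none ≈ᶜ-refl
Many-tabulate {k = suc k}  f = more _ _ ≈ᶜ-refl (f zero) (Many-tabulate (f ∘ suc))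

mutual
  sound : ∀ {m e} (t : Tm n) → Γ ⊢⟨ m , e ⟩ t ∶ L → ⟦ t ⟧ Γ L
  sound t (conv p q d)    = ⟦ t ⟧-resp p q (sound t d)
  sound (var x) ax        = ≈ᶜ-refl
  sound (ƛ t) axλ         = normal ≈ᶜ-refl
  sound (ƛ t) (lam d)     = arrow (⟦ t ⟧-respᶜ (head-tail Multiset.refl) (sound t d))
  sound (t · u) (app {Γ} {Δ} d ds) = app Γ Δ ≈ᶜ-refl (sound t d) (soundᴹ u ds)
  sound (t [\ u ]) (es {Γ} {Δ} d ds) =
    es (tail Γ) Δ ≈ᶜ-refl (⟦ t ⟧-respᶜ (head-tail Multiset.refl) (sound t d)) (soundᴹ u ds)

  soundᴹ : ∀ {m e} (t : Tm n) → Γ ⊢⟨ m , e ⟩ t ∶ᴹ M → Many ⟦ t ⟧ Γ M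
  soundᴹ t (convᴹ p q d) = Many-resp-≈ᶜ p (Many-resp-≈ᴹ ⟦ t ⟧-resp q (soundᴹ t d))
  soundᴹ t (many ds)     = Many-tabulate (λ i → sound t (ds i))

infix 3 _⊢_∶ᴹ_

_⊢_∶ᴹ_ : TyCtx n → Tm n → Multi → Set
Γ ⊢ t ∶ᴹ M = ∃[ m ] ∃[ e ] (Γ ⊢⟨ m , e ⟩ t ∶ᴹ M)

-- Conversions ending the second derivation are postponed until after the new premise is added; what
-- remains is an instance of `many`, whose families are extended by one entry.
many-∷ : ∀ {t : Tm n} → Γ ⊢ t ∶ L → Δ ⊢ t ∶ᴹ M → Γ ⊎ᶜ Δ ⊢ t ∶ᴹ L ∷ M
many-∷ {Γ = Γ} {L = L} (c , c′ , d) (_ , _ , many {Γ = Γs} {m = cs} {e = cs′} {L = Ls} ds) =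
  _ , _ , many {Γ = Γ ∷ᶜ Γs} {m = c ∷ᶜ cs} {e = c′ ∷ᶜ cs′} {L = L ∷ᶜ Ls} (λ { zero → d ; (suc i) → ds i })
many-∷ d (_ , _ , convᴹ p q ds) with many-∷ d (_ , _ , ds)
... | _ , _ , ds′ = _ , _ , convᴹ (⊎ᶜ-congˡ p) (prep ≈ᴸ-refl q) ds′

-- Completeness for `t` is a hypothesis, so that `complete` is structurally recursive on terms.
completeᴹ : ∀ {t : Tm n} → ⟦ t ⟧ ⊆ (_⊢ t ∶_) → Many ⟦ t ⟧ Γ M → Γ ⊢ t ∶ᴹ M
completeᴹ f (none eq) = _ , _ , convᴹ (≈ᶜ-sym eq) Multiset.refl (many {Γ = λ ()} {m = λ ()} {e = λ ()} {L = λ ()} λ ())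
completeᴹ f (more Γ₁ Γ₂ eq x xs) with many-∷ (f x) (completeᴹ f xs)
... | _ , _ , ds = _ , _ , convᴹ (≈ᶜ-sym eq) Multiset.refl ds

complete : (t : Tm n) → ⟦ t ⟧ ⊆ (_⊢ t ∶_)
complete (var x) eq = _ , _ , conv (≈ᶜ-sym eq) ≈ᴸ-refl ax
complete (ƛ t) (normal eq) = _ , _ , conv (≈ᶜ-sym eq) ≈ᴸ-refl axλ
complete (ƛ t) (arrow x) with complete t x
... | _ , _ , d = _ , _ , lam d
complete (t · u) (app Γ₁ Γ₂ eq x ys) with complete t x | completeᴹ (complete u) ys
... | _ , _ , d | _ , _ , ds = _ , _ , conv (≈ᶜ-sym eq) ≈ᴸ-refl (app d ds)
complete (t [\ u ]) (es Γ₁ Γ₂ eq x ys) with complete t x | completeᴹ (complete u) ys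
... | _ , _ , d | _ , _ , ds = _ , _ , conv (≈ᶜ-sym eq) ≈ᴸ-refl (es d ds)

-- Inclusion of interpretations and plugging

infix 4 _⊑_ _≅_

_⊑_ : Tm n → Tm n → Set
t ⊑ u = ⟦ t ⟧ ⊆ ⟦ u ⟧

_≅_ : Tm n → Tm n → Set
t ≅ u = (t ⊑ u) × (u ⊑ t)

≅-trans : ∀ {t u s : Tm n} → t ≅ u → u ≅ s → t ≅ s
≅-trans (f , f′) (g , g′) = (λ x → g (f x)) , (λ x → f′ (g′ x))

≅⇒≡typ : ∀ {t u : Tm n} → t ≅ u → t ≡typ u
≅⇒≡typ {t = t} {u} (f , g) Γ L =
  mk⇔ (λ { (_ , _ , d) → complete u (f (sound t d)) }) (λ { (_ , _ , d) → complete t (g (sound u d)) })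

≡typ⇒≅ : ∀ {t u : Tm n} → t ≡typ u → t ≅ u
≡typ⇒≅ {t = t} {u} eq =
  (λ x → sound u (proj₂ (proj₂ (Equivalence.to (eq _ _) (complete t x))))) ,
  (λ x → sound t (proj₂ (proj₂ (Equivalence.from (eq _ _) (complete u x)))))

⊑-plug : ∀ {t u : Tm k} (C : Ctx n k) → t ⊑ u → C ⟨ t ⟩ ⊑ C ⟨ u ⟩
⊑-plug ∙           f = f
⊑-plug (ƛ C)       f = Abs-mono (⊑-plug C f)
⊑-plug (C ·ˡ u)    f = App-mono (⊑-plug C f) (λ x → x)
⊑-plug (u ·ʳ C)    f = App-mono (λ x → x) (⊑-plug C f)
⊑-plug (u [\ C ]ʳ) f = Es-mono (λ x → x) (⊑-plug C f)
⊑-plug (C [\ u ]ˡ) f = Es-mono (⊑-plug C f) (λ x → x)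

⊑-plugʷ : ∀ {t u : Tm k} (W : WeakCtx n k) → t ⊑ u → W ⟨ t ⟩ʷ ⊑ W ⟨ u ⟩ʷ
⊑-plugʷ ∙           f = f
⊑-plugʷ (W ·ˡ u)    f = App-mono (⊑-plugʷ W f) (λ x → x)
⊑-plugʷ (u ·ʳ W)    f = App-mono (λ x → x) (⊑-plugʷ W f)
⊑-plugʷ (u [\ W ]ʳ) f = Es-mono (λ x → x) (⊑-plugʷ W f)
⊑-plugʷ (W [\ u ]ˡ) f = Es-mono (⊑-plugʷ W f) (λ x → x)

-- Renaming

lift-id : {ρ : Fin n → Fin n} → (∀ x → ρ x ≡ x) → ∀ x → lift ρ x ≡ x
lift-id eq zero    = ≡.refl
lift-id eq (suc x) = cong suc (eq x)

-- The hypothesis is pointwise because `lift` of the identity is the identity only pointwise.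
-- Plugging into an empty context renames by the identity, which this removes.
rename-id : {ρ : Fin n → Fin n} → (∀ x → ρ x ≡ x) → ∀ t → rename ρ t ≡ t
rename-id eq (var x)    = cong var (eq x)
rename-id eq (ƛ t)      = cong ƛ (rename-id (lift-id eq) t)
rename-id eq (t · u)    = cong₂ _·_ (rename-id eq t) (rename-id eq u)
rename-id eq (t [\ u ]) = cong₂ _[\_] (rename-id (lift-id eq) t) (rename-id eq u)

lift-∘ : ∀ {j} {ρ : Fin k → Fin j} {σ : Fin n → Fin k} {τ} →
         (∀ x → τ x ≡ ρ (σ x)) → ∀ x → lift τ x ≡ lift ρ (lift σ x)
lift-∘ eq zero    = ≡.refl
lift-∘ eq (suc x) = cong suc (eq x)

rename-∘ : ∀ {j} {ρ : Fin k → Fin j} {σ : Fin n → Fin k} {τ} →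
           (∀ x → τ x ≡ ρ (σ x)) → ∀ t → rename τ t ≡ rename ρ (rename σ t)
rename-∘ eq (var x)    = cong var (eq x)
rename-∘ eq (ƛ t)      = cong ƛ (rename-∘ (lift-∘ eq) t)
rename-∘ eq (t · u)    = cong₂ _·_ (rename-∘ eq t) (rename-∘ eq u)
rename-∘ eq (t [\ u ]) = cong₂ _[\_] (rename-∘ (lift-∘ eq) t) (rename-∘ eq u)

-- Plugging `t` past one more binder is plugging `weaken t` into the inner context. This is the
-- inductive step of every proof by induction on a context below that crosses a binder.
rename-∘-suc : (ρ : Fin (suc n) → Fin k) (t : Tm n) → rename (ρ ∘ suc) t ≡ rename ρ (weaken t)
rename-∘-suc ρ = rename-∘ (λ x → ≡.refl)

-- The renamings met when weaken goes under binders.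
data Thinning : ∀ {n k} → (Fin n → Fin k) → Set where
  wk    : Thinning {n} suc
  under : {ρ : Fin n → Fin k} → Thinning ρ → Thinning (lift ρ)

-- A thinning misses exactly one index; `push` inserts `[]` there.
push : {ρ : Fin n → Fin k} → Thinning ρ → TyCtx n → TyCtx k
push wk        Γ = [] ∷ᶜ Γ
push (under r) Γ = head Γ ∷ᶜ push r (tail Γ)

private
  variable
    ρ : Fin n → Fin k

push-cong : (r : Thinning ρ) → Γ ≈ᶜ Δ → push r Γ ≈ᶜ push r Δ
push-cong wk        p = ∷ᶜ-cong Multiset.refl p
push-cong (under r) p = ∷ᶜ-cong (p zero) (push-cong r (p ∘ suc))

push-∅ : (r : Thinning ρ) → push r ∅ ≈ᶜ ∅
push-∅ wk        zero    = Multiset.refl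
push-∅ wk        (suc x) = Multiset.refl
push-∅ (under r) zero    = Multiset.refl
push-∅ (under r) (suc x) = push-∅ r x

push-⊎ᶜ : (r : Thinning ρ) → push r (Γ ⊎ᶜ Δ) ≈ᶜ push r Γ ⊎ᶜ push r Δ
push-⊎ᶜ wk        zero    = Multiset.refl
push-⊎ᶜ wk        (suc x) = Multiset.refl
push-⊎ᶜ (under r) zero    = Multiset.refl
push-⊎ᶜ (under r) (suc x) = push-⊎ᶜ r x

push-∶[] : (r : Thinning ρ) (x : Fin _) → push r (x ∶[ L ]) ≈ᶜ ρ x ∶[ L ]
push-∶[] wk        x       zero    = Multiset.refl
push-∶[] wk        x       (suc y) = Multiset.refl
push-∶[] (under r) zero    zero    = Multiset.refl
push-∶[] (under r) zero    (suc y) = push-∅ r y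
push-∶[] (under r) (suc x) zero    = Multiset.refl
push-∶[] (under r) (suc x) (suc y) = push-∶[] r x y

push-under : (r : Thinning ρ) → push (under r) (M ∷ᶜ Γ) ≈ᶜ M ∷ᶜ push r Γ
push-under r zero    = Multiset.refl
push-under r (suc x) = Multiset.refl

push-split : (r : Thinning ρ) → Γ ≈ᶜ Γ′ ⊎ᶜ Δ → push r Γ ≈ᶜ push r Γ′ ⊎ᶜ push r Δ
push-split r p = ≈ᶜ-trans (push-cong r p) (push-⊎ᶜ r)

push-merge : ∀ (r : Thinning ρ) {Γ₁ Γ₂ Δ₁ Δ₂} →
             Γ ≈ᶜ Γ₁ ⊎ᶜ Γ₂ → Γ₁ ≈ᶜ push r Δ₁ → Γ₂ ≈ᶜ push r Δ₂ → Γ ≈ᶜ push r (Δ₁ ⊎ᶜ Δ₂)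
push-merge r p q₁ q₂ = ≈ᶜ-trans p (≈ᶜ-trans (⊎ᶜ-cong q₁ q₂) (≈ᶜ-sym (push-⊎ᶜ r)))

Many-push : (r : Thinning ρ) → (∀ {Γ L} → P Γ L → Q (push r Γ) L) →
            Many P Γ M → Many Q (push r Γ) M
Many-push r f (none p)             = none (≈ᶜ-trans (push-cong r p) (push-∅ r))
Many-push r f (more Γ₁ Γ₂ p x xs) = more (push r Γ₁) (push r Γ₂) (push-split r p) (f x) (Many-push r f xs)

Many-push⁻ : (r : Thinning ρ) → (∀ {Γ L} → Q Γ L → ∃[ Δ ] (Γ ≈ᶜ push r Δ) × P Δ L) →
             Many Q Γ M → ∃[ Δ ] (Γ ≈ᶜ push r Δ) × Many P Δ M
Many-push⁻ r f (none p) = ∅ , ≈ᶜ-trans p (≈ᶜ-sym (push-∅ r)) , none ≈ᶜ-refl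
Many-push⁻ r f (more Γ₁ Γ₂ p x xs) with f x | Many-push⁻ r f xs
... | Δ₁ , q₁ , y | Δ₂ , q₂ , ys = Δ₁ ⊎ᶜ Δ₂ , push-merge r p q₁ q₂ , more Δ₁ Δ₂ ≈ᶜ-refl y ys

rename-push : (r : Thinning ρ) (t : Tm _) → ⟦ t ⟧ Γ L → ⟦ rename ρ t ⟧ (push r Γ) L
rename-push r (var x) p = ≈ᶜ-trans (push-cong r p) (push-∶[] r x)
rename-push r (ƛ t) (normal p) = normal (≈ᶜ-trans (push-cong r p) (push-∅ r))
rename-push r (ƛ t) (arrow x) = arrow (⟦ _ ⟧-respᶜ (push-under r) (rename-push (under r) t x))
rename-push r (t · u) (app Γ₁ Γ₂ p x ys) =
  app (push r Γ₁) (push r Γ₂) (push-split r p) (rename-push r t x) (Many-push r (rename-push r u) ys)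
rename-push r (t [\ u ]) (es Γ₁ Γ₂ p x ys) =
  es (push r Γ₁) (push r Γ₂) (push-split r p)
    (⟦ _ ⟧-respᶜ (push-under r) (rename-push (under r) t x)) (Many-push r (rename-push r u) ys)

-- The missed variable does not occur in the renamed term, so every typing of that term has `[]` at
-- it and comes from a typing of `t`.
rename-push⁻ : (r : Thinning ρ) (t : Tm _) → ⟦ rename ρ t ⟧ Γ L → ∃[ Δ ] (Γ ≈ᶜ push r Δ) × ⟦ t ⟧ Δ L
rename-push⁻ r (var x) p = _ , ≈ᶜ-trans p (≈ᶜ-sym (push-∶[] r x)) , ≈ᶜ-refl
rename-push⁻ r (ƛ t) (normal p) = ∅ , ≈ᶜ-trans p (≈ᶜ-sym (push-∅ r)) , normal ≈ᶜ-refl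
rename-push⁻ r (ƛ t) (arrow x) with rename-push⁻ (under r) t x
-- A lifted thinning fixes `zero`, so `q zero` identifies `head Δ` with the type of the bound
-- variable.
... | Δ , q , y = tail Δ , q ∘ suc , arrow (⟦ t ⟧-respᶜ (head-tail (Multiset.sym (q zero))) y)
rename-push⁻ r (t · u) (app Γ₁ Γ₂ p x ys)
  with rename-push⁻ r t x | Many-push⁻ r (rename-push⁻ r u) ys
... | Δ₁ , q₁ , x′ | Δ₂ , q₂ , ys′ = Δ₁ ⊎ᶜ Δ₂ , push-merge r p q₁ q₂ , app Δ₁ Δ₂ ≈ᶜ-refl x′ ys′
rename-push⁻ r (t [\ u ]) (es Γ₁ Γ₂ p x ys)
  with rename-push⁻ (under r) t x | Many-push⁻ r (rename-push⁻ r u) ys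
... | Δ₁ , q₁ , x′ | Δ₂ , q₂ , ys′ =
  tail Δ₁ ⊎ᶜ Δ₂ , push-merge r p (q₁ ∘ suc) q₂ ,
  es (tail Δ₁) Δ₂ ≈ᶜ-refl (⟦ t ⟧-respᶜ (head-tail (Multiset.sym (q₁ zero))) x′) ys′

weaken-⟦⟧ : (t : Tm n) → ⟦ t ⟧ Γ L → ⟦ weaken t ⟧ ([] ∷ᶜ Γ) L
weaken-⟦⟧ = rename-push wk

weaken-⟦⟧⁻ : (t : Tm n) → ⟦ weaken t ⟧ Γ L → ∃[ Δ ] (Γ ≈ᶜ [] ∷ᶜ Δ) × ⟦ t ⟧ Δ L
weaken-⟦⟧⁻ = rename-push⁻ wk

weaken-Many : (t : Tm n) → Many ⟦ t ⟧ Γ M → Many ⟦ weaken t ⟧ ([] ∷ᶜ Γ) M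
weaken-Many t = Many-push wk (weaken-⟦⟧ t)

weaken-Many⁻ : (t : Tm n) → Many ⟦ weaken t ⟧ Γ M → ∃[ Δ ] (Γ ≈ᶜ [] ∷ᶜ Δ) × Many ⟦ t ⟧ Δ M
weaken-Many⁻ t = Many-push⁻ wk (weaken-⟦⟧⁻ t)

∷ᶜ-weaken : ∀ {Γ₁ Γ₂ : TyCtx n} → M ∷ᶜ (Γ₁ ⊎ᶜ Γ₂) ≈ᶜ (M ∷ᶜ Γ₁) ⊎ᶜ ([] ∷ᶜ Γ₂)
∷ᶜ-weaken zero    = Multiset.sym (Multiset.identityʳ _)
∷ᶜ-weaken (suc x) = Multiset.refl

-- The second summand has `[]` at index zero, so the whole of `M` comes from the first one. This
-- takes the typing of a weakened term out of the scope of a binder.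
∷ᶜ-weaken⁻ : ∀ {Γ₁ : TyCtx n} {Γ₂ Γ₃ Δ} → M ∷ᶜ Γ₁ ≈ᶜ Γ₂ ⊎ᶜ Γ₃ → Γ₃ ≈ᶜ [] ∷ᶜ Δ →
             (Γ₂ ≈ᶜ M ∷ᶜ tail Γ₂) × (Γ₁ ≈ᶜ tail Γ₂ ⊎ᶜ Δ)
∷ᶜ-weaken⁻ {Γ₂ = Γ₂} p q =
  head-tail (Multiset.sym (trans (p zero) (trans (Multiset.∙-congˡ {head Γ₂} (q zero)) (Multiset.identityʳ _)))) ,
  ≈ᶜ-trans (p ∘ suc) (⊎ᶜ-congˡ {x = tail Γ₂} (q ∘ suc))

-- Replacement of the term plugged in a weak context

-- The hole may lie in an argument, which is typed several times, so its typings are collected in a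
-- multi type. `A` is `Linear` for the typings of a term and `Multi` for those of an argument.
record Splits {A : Set} (t : Tm n) (F : Tm n → TyCtx n → A → Set) (Γ : TyCtx n) (a : A) : Set where
  constructor split
  field
    holeType         : Multi
    outerCtx holeCtx : TyCtx n
    splitting        : Γ ≈ᶜ outerCtx ⊎ᶜ holeCtx
    holeTyping       : Many ⟦ t ⟧ holeCtx holeType
    fill             : ∀ u {Δ} → Many ⟦ u ⟧ Δ holeType → F u (outerCtx ⊎ᶜ Δ) a

-- The hole types and contexts of the single typings are added up; a filling of the sum is cut into
-- fillings of the summands by `Many-++⁻`.
Many-splits : ∀ {t : Tm n} {F : Tm n → Typings n} →
              (∀ {Γ L} → F t Γ L → Splits t F Γ L) →
              Many (F t) Γ N → Splits t (Many ∘ F) Γ N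
Many-splits f (none p) =
  split [] ∅ ∅ p (none ≈ᶜ-refl) (λ { u (none q) → none q })
Many-splits {t = t} {F} f (more Γ₁ Γ₂ p x xs) with f x | Many-splits {F = F} f xs
... | split M₁ Δ₁ Δ₁′ q₁ ys₁ fill₁ | split M₂ Δ₂ Δ₂′ q₂ ys₂ fill₂ =
  split (M₁ ++ M₂) (Δ₁ ⊎ᶜ Δ₂) (Δ₁′ ⊎ᶜ Δ₂′)
    (≈ᶜ-trans p (≈ᶜ-trans (⊎ᶜ-cong q₁ q₂) (interchange Δ₁ Δ₁′ Δ₂ Δ₂′)))
    (Many-++ ys₁ ys₂) fill
  where
  fill : ∀ u {Δ} → Many ⟦ u ⟧ Δ (M₁ ++ M₂) → Many (F u) ((Δ₁ ⊎ᶜ Δ₂) ⊎ᶜ Δ) _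
  fill u zs with Many-++⁻ M₁ zs
  ... | Δ₃ , Δ₄ , q , zs₁ , zs₂ =
    more (Δ₁ ⊎ᶜ Δ₃) (Δ₂ ⊎ᶜ Δ₄) (≈ᶜ-trans (⊎ᶜ-congˡ q) (interchange Δ₁ Δ₂ Δ₃ Δ₄))
      (fill₁ u zs₁) (fill₂ u zs₂)

weak-splits : (W : WeakCtx n k) (t : Tm n) → ⟦ W ⟨⟨ t ⟩⟩ʷ ⟧ Γ L → Splits t (λ u → ⟦ W ⟨⟨ u ⟩⟩ʷ ⟧) Γ L
weak-splits {Γ = Γ} {L} ∙ t x rewrite rename-id {ρ = λ y → y} (λ _ → ≡.refl) t =
  split [ L ] ∅ Γ ≈ᶜ-refl (Many-[] x) λ u ys →
    ≡.subst (λ v → ⟦ v ⟧ _ L) (≡.sym (rename-id (λ _ → ≡.refl) u))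
      (Many-[]⁻ ⟦ u ⟧-resp ys)
weak-splits (W ·ˡ s) t (app Γ₁ Γ₂ p x ys) with weak-splits W t x
... | split M Δ₁ Δ₂ q zs fill =
  split M (Δ₁ ⊎ᶜ Γ₂) Δ₂ (≈ᶜ-trans p (≈ᶜ-trans (⊎ᶜ-congʳ q) (xy∙z≈xz∙y Δ₁ Δ₂ Γ₂))) zs
    λ u {Δ} zs′ → app (Δ₁ ⊎ᶜ Δ) Γ₂ (xy∙z≈xz∙y Δ₁ Γ₂ Δ) (fill u zs′) ys
weak-splits (s ·ʳ W) t (app Γ₁ Γ₂ p x ys) with Many-splits {F = λ u → ⟦ W ⟨⟨ u ⟩⟩ʷ ⟧} (weak-splits W t) ys
... | split M Δ₁ Δ₂ q zs fill =
  split M (Γ₁ ⊎ᶜ Δ₁) Δ₂ (≈ᶜ-trans p (≈ᶜ-trans (⊎ᶜ-congˡ q) (≈ᶜ-sym (⊎ᶜ-assoc Γ₁ Δ₁ Δ₂)))) zs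
    λ u {Δ} zs′ → app Γ₁ (Δ₁ ⊎ᶜ Δ) (⊎ᶜ-assoc Γ₁ Δ₁ Δ) x (fill u zs′)
weak-splits (s [\ W ]ʳ) t (es Γ₁ Γ₂ p x ys) with Many-splits {F = λ u → ⟦ W ⟨⟨ u ⟩⟩ʷ ⟧} (weak-splits W t) ys
... | split M Δ₁ Δ₂ q zs fill =
  split M (Γ₁ ⊎ᶜ Δ₁) Δ₂ (≈ᶜ-trans p (≈ᶜ-trans (⊎ᶜ-congˡ q) (≈ᶜ-sym (⊎ᶜ-assoc Γ₁ Δ₁ Δ₂)))) zs
    λ u {Δ} zs′ → es Γ₁ (Δ₁ ⊎ᶜ Δ) (⊎ᶜ-assoc Γ₁ Δ₁ Δ) x (fill u zs′)
-- The typings of `weaken t` have `[]` at the bound variable, so the type of that variable comes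
-- from the outer context alone. Filling in another weakened term does not change it, and the
-- typings `ys` of `s` still fit.
weak-splits (W [\ s ]ˡ) t (es Γ₁ Γ₂ p x ys)
  rewrite rename-∘-suc (pastʷ W) t with weak-splits W (weaken t) x
... | split M Δ₁ Δ₂ q zs fill with weaken-Many⁻ t zs
... | Δ₃ , q₁ , zs₁ with ∷ᶜ-weaken⁻ q q₁
... | q₂ , q₃ =
  split M (tail Δ₁ ⊎ᶜ Γ₂) Δ₃
    (≈ᶜ-trans p (≈ᶜ-trans (⊎ᶜ-congʳ q₃) (xy∙z≈xz∙y (tail Δ₁) Δ₃ Γ₂))) zs₁
    λ u {Δ} zs′ →
      es (tail Δ₁ ⊎ᶜ Δ) Γ₂ (xy∙z≈xz∙y (tail Δ₁) Γ₂ Δ)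
        (≡.subst (λ v → ⟦ W ⟨ v ⟩ʷ ⟧ _ _) (≡.sym (rename-∘-suc (pastʷ W) u))
          (⟦ W ⟨⟨ weaken u ⟩⟩ʷ ⟧-respᶜ (≈ᶜ-trans (⊎ᶜ-congʳ q₂) (≈ᶜ-sym ∷ᶜ-weaken))
            (fill (weaken u) (weaken-Many u zs′))))
        ys

-- Root rules

Many-var : ∀ M → Many ⟦ var zero ⟧ (M ∷ᶜ ∅ {n}) M
Many-var []      = none λ { zero → Multiset.refl ; (suc x) → Multiset.refl }
Many-var (L ∷ M) = more (zero ∶[ L ]) (M ∷ᶜ ∅) (λ { zero → Multiset.refl ; (suc x) → Multiset.refl }) ≈ᶜ-refl (Many-var M)

-- An axiom puts in the context exactly the type that it assigns.
Many-var⁻ : Many ⟦ var zero ⟧ Γ M → Γ ≈ᶜ M ∷ᶜ ∅ {n}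
Many-var⁻ (none p) = λ { zero → p zero ; (suc x) → p (suc x) }
Many-var⁻ (more Γ₁ Γ₂ p q xs) =
  ≈ᶜ-trans p (≈ᶜ-trans (⊎ᶜ-cong q (Many-var⁻ xs)) λ { zero → Multiset.refl ; (suc x) → Multiset.refl })

-- In both directions the extra `𝚗` stays with the explicit substitution, and only the typings of
-- `u` for the hole type `N` move.
e-≅ : (W : WeakCtx (suc n) k) (u : Tm n) → W ⟨⟨ var zero ⟩⟩ʷ [\ u ] ≅ W ⟨⟨ weaken u ⟩⟩ʷ [\ u ]
e-≅ W u = to , from
  where
  to : W ⟨⟨ var zero ⟩⟩ʷ [\ u ] ⊑ W ⟨⟨ weaken u ⟩⟩ʷ [\ u ]
  to (es Γ₁ Γ₂ p x ys) with weak-splits W (var zero) x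
  ... | split N Δ₁ Δ₂ q zs fill with Many-var⁻ zs
  -- By `q zero` and `r zero` the type of the variable is `head Δ₁ ++ N`, where `N` is for the
  -- replaced occurrence and `head Δ₁` for the others. The part `N` is brought to the front and cut
  -- off.
  ... | r with Many-++⁻ N (Many-resp-≈ᴹ ⟦ u ⟧-resp
                 (trans (Multiset.∙-congʳ (trans (q zero) (Multiset.∙-congˡ {head Δ₁} (r zero))))
                        (Multiset.xy∙z≈y∙xz (head Δ₁) N [ 𝚗 ])) ys)
  ... | Γ₃ , Γ₄ , q′ , ys₁ , ys₂ =
    es (tail Δ₁ ⊎ᶜ Γ₃) Γ₄
      (≈ᶜ-trans p (≈ᶜ-trans (⊎ᶜ-cong Γ₁≈tailΔ₁ q′) (≈ᶜ-sym (⊎ᶜ-assoc (tail Δ₁) Γ₃ Γ₄))))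
      (⟦ W ⟨⟨ weaken u ⟩⟩ʷ ⟧-respᶜ (≈ᶜ-trans (⊎ᶜ-congʳ (head-tail Multiset.refl)) (≈ᶜ-sym ∷ᶜ-weaken))
        (fill (weaken u) (weaken-Many u ys₁)))
      ys₂
    where
    Γ₁≈tailΔ₁ : Γ₁ ≈ᶜ tail Δ₁
    Γ₁≈tailΔ₁ = ≈ᶜ-trans (q ∘ suc) (≈ᶜ-trans (⊎ᶜ-congˡ {x = tail Δ₁} (r ∘ suc)) (⊎ᶜ-identityʳ (tail Δ₁)))

  from : W ⟨⟨ weaken u ⟩⟩ʷ [\ u ] ⊑ W ⟨⟨ var zero ⟩⟩ʷ [\ u ]
  from (es {M} Γ₁ Γ₂ p x ys) with weak-splits W (weaken u) x
  ... | split N Δ₁ Δ₂ q zs fill with weaken-Many⁻ u zs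
  ... | Δ₃ , q₁ , zs₁ with ∷ᶜ-weaken⁻ q q₁
  ... | q₂ , q₃ =
    -- The other occurrences of the variable account for `M`, the one put in the hole for `N`.
    es {M = M ++ N} (tail Δ₁) (Δ₃ ⊎ᶜ Γ₂)
      (≈ᶜ-trans p (≈ᶜ-trans (⊎ᶜ-congʳ q₃) (⊎ᶜ-assoc (tail Δ₁) Δ₃ Γ₂)))
      (⟦ W ⟨⟨ var zero ⟩⟩ʷ ⟧-respᶜ
        (≈ᶜ-trans (⊎ᶜ-congʳ q₂) λ { zero → Multiset.refl ; (suc x) → Multiset.identityʳ _ })
        (fill (var zero) (Many-var N)))
      (Many-resp-≈ᴹ ⟦ u ⟧-resp (Multiset.x∙yz≈yx∙z N M [ 𝚗 ]) (Many-++ zs₁ ys))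

-- One explicit substitution of `S` is moved over the argument. As `weaken u` puts nothing at the
-- bound variable, both sides have the same premises, nested in another order.
es-· : (t : Tm (suc n)) (s u : Tm n) → (t [\ s ]) · u ≅ (t · weaken u) [\ s ]
es-· t s u = to , from
  where
  to : (t [\ s ]) · u ⊑ (t · weaken u) [\ s ]
  to (app Γ₁ Γ₂ p (es Γ₃ Γ₄ q x ys) zs) =
    es (Γ₃ ⊎ᶜ Γ₂) Γ₄ (≈ᶜ-trans p (≈ᶜ-trans (⊎ᶜ-congʳ q) (xy∙z≈xz∙y Γ₃ Γ₄ Γ₂)))
      (app (_ ∷ᶜ Γ₃) ([] ∷ᶜ Γ₂) ∷ᶜ-weaken x (weaken-Many u zs)) ys

  from : (t · weaken u) [\ s ] ⊑ (t [\ s ]) · u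
  from (es Γ₁ Γ₂ p (app Γ₃ Γ₄ q x ys) zs) with weaken-Many⁻ u ys
  ... | Δ , q₁ , ys₁ with ∷ᶜ-weaken⁻ q q₁
  ... | q₂ , q₃ =
    app (tail Γ₃ ⊎ᶜ Γ₂) Δ (≈ᶜ-trans p (≈ᶜ-trans (⊎ᶜ-congʳ q₃) (xy∙z≈xz∙y (tail Γ₃) Δ Γ₂)))
      (es (tail Γ₃) Γ₂ ≈ᶜ-refl (⟦ t ⟧-respᶜ q₂ x) zs) ys₁

-- For empty `S`, a function type forces the abstraction to be typed by `arrow`, and the remaining
-- premises are those of the explicit substitution, `𝚗` included.
m-≅ : (S : SubstCtx n k) (t : Tm (suc k)) (u : Tm n) →
      S ⟨ ƛ t ⟩ˢ · u ≅ S ⟨ t [\ rename (pastˢ S) u ] ⟩ˢ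
m-≅ ∙ t u rewrite rename-id {ρ = λ x → x} (λ _ → ≡.refl) u =
  (λ { (app Γ₁ Γ₂ p (arrow x) ys) → es Γ₁ Γ₂ p x ys }) ,
  (λ { (es Γ₁ Γ₂ p x ys) → app Γ₁ Γ₂ p (arrow x) ys })
m-≅ (S [\ s ]) t u rewrite rename-∘-suc (pastˢ S) u with m-≅ S t (weaken u)
... | f , g = ≅-trans (es-· (S ⟨ ƛ t ⟩ˢ) s u) (Es-mono f (λ x → x) , Es-mono g (λ x → x))

-- Midpoint of garbage collection: the argument is typed once, with `𝚗`, beside the body that does
-- not use it.
data Both (P Q : Typings n) (Γ : TyCtx n) (L : Linear) : Set where
  both : ∀ Γ₁ Γ₂ → Γ ≈ᶜ Γ₁ ⊎ᶜ Γ₂ → P Γ₁ 𝚗 → Q Γ₂ L → Both P Q Γ L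

-- The bound variable of a weakened body has type `[]`, so the argument has only the multi type
-- `[ 𝚗 ]`.
weaken-[\] : (t s : Tm n) → ⟦ weaken t [\ s ] ⟧ ⊆ Both ⟦ s ⟧ ⟦ t ⟧
weaken-[\] t s (es Γ₁ Γ₂ p x ys) with weaken-⟦⟧⁻ t x
... | Δ , q , x′ =
  both Γ₂ Δ (≈ᶜ-trans p (≈ᶜ-trans (⊎ᶜ-congʳ (q ∘ suc)) (⊎ᶜ-comm Δ Γ₂)))
    (Many-[]⁻ ⟦ s ⟧-resp (Many-resp-≈ᴹ ⟦ s ⟧-resp (Multiset.∙-congʳ (q zero)) ys)) x′

weaken-[\]⁻ : (t s : Tm n) → Both ⟦ s ⟧ ⟦ t ⟧ ⊆ ⟦ weaken t [\ s ] ⟧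
weaken-[\]⁻ t s (both Γ₁ Γ₂ p x y) =
  es {M = []} Γ₂ Γ₁ (≈ᶜ-trans p (⊎ᶜ-comm Γ₁ Γ₂)) (weaken-⟦⟧ t y) (Many-[] x)

-- An abstraction has type `𝚗` only in the empty context, so replacing it by `t` loses nothing,
-- while the typings of the substitutions in `S` are kept.
subst-both : (S : SubstCtx n k) (t : Tm n) {v : Tm k} → Value v →
             Both ⟦ S ⟨ v ⟩ˢ ⟧ ⟦ t ⟧ ⊆ ⟦ S ⟨⟨ t ⟩⟩ˢ ⟧
subst-both ∙ t (ƛ _) (both Γ₁ Γ₂ p (normal q) y)
  rewrite rename-id {ρ = λ x → x} (λ _ → ≡.refl) t =
  ⟦ t ⟧-respᶜ (≈ᶜ-sym (≈ᶜ-trans p (⊎ᶜ-congʳ q))) y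
subst-both (S [\ s ]) t v (both Γ₁ Γ₂ p (es Γ₃ Γ₄ q x ys) z)
  rewrite rename-∘-suc (pastˢ S) t =
  es (Γ₃ ⊎ᶜ Γ₂) Γ₄ (≈ᶜ-trans p (≈ᶜ-trans (⊎ᶜ-congʳ q) (xy∙z≈xz∙y Γ₃ Γ₄ Γ₂)))
    (subst-both S (weaken t) v (both (_ ∷ᶜ Γ₃) ([] ∷ᶜ Γ₂) ∷ᶜ-weaken x (weaken-⟦⟧ t z))) ys

-- Conversely, any value can be put back beside `t`, since `𝚗` is available for it in the empty
-- context.
subst-both⁻ : (S : SubstCtx n k) (t : Tm n) {v : Tm k} → Value v →
              ⟦ S ⟨⟨ t ⟩⟩ˢ ⟧ ⊆ Both ⟦ S ⟨ v ⟩ˢ ⟧ ⟦ t ⟧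
subst-both⁻ ∙ t (ƛ _) {Γ} x rewrite rename-id {ρ = λ x → x} (λ _ → ≡.refl) t =
  both ∅ Γ ≈ᶜ-refl (normal ≈ᶜ-refl) x
subst-both⁻ (S [\ s ]) t {v} val (es Γ₁ Γ₂ p x ys)
  rewrite rename-∘-suc (pastˢ S) t with subst-both⁻ S (weaken t) val x
... | both Γ₃ Γ₄ q y z with weaken-⟦⟧⁻ t z
... | Δ , q₁ , z₁ with ∷ᶜ-weaken⁻ q q₁
... | q₂ , q₃ =
  both (tail Γ₃ ⊎ᶜ Γ₂) Δ (≈ᶜ-trans p (≈ᶜ-trans (⊎ᶜ-congʳ q₃) (xy∙z≈xz∙y (tail Γ₃) Δ Γ₂)))
    (es (tail Γ₃) Γ₂ ≈ᶜ-refl (⟦ S ⟨ v ⟩ˢ ⟧-respᶜ q₂ y) ys) z₁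

gcv-≅ : (t : Tm n) (S : SubstCtx n k) {v : Tm k} → Value v → weaken t [\ S ⟨ v ⟩ˢ ] ≅ S ⟨⟨ t ⟩⟩ˢ
gcv-≅ t S {v} val =
  (λ x → subst-both S t val (weaken-[\] t (S ⟨ v ⟩ˢ) x)) ,
  (λ x → weaken-[\]⁻ t (S ⟨ v ⟩ˢ) (subst-both⁻ S t val x))

-- Closure under weak contexts and conclusion

WeakClosure-≅ : {R : ∀ {k} → Tm k → Tm k → Set} → (∀ {k} {t u : Tm k} → R t u → t ≅ u) →
                {t u : Tm n} → WeakClosure R t u → t ≅ u
WeakClosure-≅ R⇒≅ (close W r) = ⊑-plugʷ W (proj₁ (R⇒≅ r)) , ⊑-plugʷ W (proj₂ (R⇒≅ r))

→w⇒≅ : {t u : Tm n} → t →w u → t ≅ u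
→w⇒≅ (inj₁ r)        = WeakClosure-≅ (λ { (m S t u) → m-≅ S t u }) r
→w⇒≅ (inj₂ (inj₁ r)) = WeakClosure-≅ (λ { (e W u) → e-≅ W u }) r
→w⇒≅ (inj₂ (inj₂ r)) = WeakClosure-≅ (λ { (gcv t S v) → gcv-≅ t S v }) r

theorem6p8 : (∀ {n : ℕ} {t u : Tm n} → t →w u → t ≡typ u)
    × (∀ {n k : ℕ} {t u : Tm k} → t ≡typ u → (C : Ctx n k) → C ⟨ t ⟩ ≡typ C ⟨ u ⟩)
theorem6p8 = invariance , compatibility
  where
  invariance : ∀ {n : ℕ} {t u : Tm n} → t →w u → t ≡typ u
  invariance r = ≅⇒≡typ (→w⇒≅ r)

  compatibility : ∀ {n k : ℕ} {t u : Tm k} → t ≡typ u → (C : Ctx n k) → C ⟨ t ⟩ ≡typ C ⟨ u ⟩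
  compatibility eq C = ≅⇒≡typ (⊑-plug C (proj₁ (≡typ⇒≅ eq)) , ⊑-plug C (proj₂ (≡typ⇒≅ eq)))
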